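{- For every finite graph $G$ with at least one edge and every positive integer $r$, \[ \mathrm{scol}_r(G)\le \biggl(3+\mathrm{tww}(G)\sum_{i=0}^{r-1}(\mathrm{tww}(G)-1)^{i}\biggr)\,\bar\omega(G)\le \bigl(\mathrm{tww}(G)^r+3\bigr)\,\bar\omega(G), \] with the convention $0^0=1$.
   Context: $\bar\omega(G)$ denotes the maximum integer $s$ such that the complete bipartite graph $K_{s,s}$ is a subgraph of $G$. Twin-width: a trigraph is a vertex set together with two disjoint sets of edges, black and red. Contracting two vertices $x,y$ of a trigraph produces a trigraph in which $x,y$ are replaced by a new vertex $z$ adjacent to every other vertex $w$ adjacent (by any edge) to $x$ or to $y$; the edge $zw$ is black if $xw$ and $yw$ are both black edges, and red otherwise; all other edges are unchanged. A $d$-contraction sequence of an $n$-vertex graph $G$ is a sequence of trigraphs $\mathbf G_n,\dots,\mathbf G_1$ where $\mathbf G_n$ is $G$ with all edges black, each $\mathbf G_i$ is obtained from $\mathbf G_{i+1}$ by one contraction, $\mathbf G_1$ has a single vertex, and every vertex of every $\mathbf G_i$ is incident to at most $d$ red edges. The twin-width $\mathrm{tww}(G)$ is the minimum $d$ for which $G$ has a $d$-contraction sequence. Strong colouring number: for a linear order $L$ of $V(G)$, a vertex $u$ is strongly $r$-reachable from $v$ if there is a path of length at most $r$ between $u$ and $v$ with $u\le_L v$ and all inner vertices $w$ satisfying $v<_L w$; $\mathrm{Sreach}_r[L,v]$ is the set of such $u$ (including $v$), and $\mathrm{scol}_r(G)=\min_L\max_{v}|\mathrm{Sreach}_r[L,v]|$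 over linear orders $L$ of $V(G)$. -}

module Defs where

open import Data.Bool using (Bool; true; T)
import Data.Bool.Properties as Bool
open import Data.Empty using (⊥-elim)
open import Data.Fin using (Fin; zero; suc; toℕ; fromℕ; inject₁; punchIn)
open import Data.Fin.Properties using (_≟_; any?; all?; injective⇒≤)
open import Data.Fin.Subset using (Subset; ∣_∣; _∈_)
open import Data.Fin.Subset.Properties using (p⊆q⇒∣p∣≤∣q∣; ∣p∣≤n)
open import Data.Integer as ℤ using (ℤ; 0ℤ)
open import Data.List as List using ()
import Data.List.Extrema.Nat as Extrema
import Data.List.Properties as List
open import Data.Nat as ℕ using (ℕ; zero; suc; _+_; _≤_; _<_; z≤n; s≤s)
import Data.Nat.Properties as ℕ
open import Data.Product using (Σ; ∃; _×_; _,_; proj₁; proj₂)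
open import Data.Sum as Sum using (_⊎_; inj₁; inj₂)
open import Data.Vec as Vec using (Vec; []; _∷_; lookup; tabulate)
open import Data.Vec.Properties using (lookup∘tabulate; []=⇒lookup; lookup⇒[]=)
open import Function using (_∘_; id)
open import Function.Definitions using (Injective)
open import Level using (Level; 0ℓ)
open import Relation.Binary using (Rel; Decidable; Symmetric; IsTotalOrder; IsDecTotalOrder)
open import Relation.Binary.PropositionalEquality using (_≡_; _≢_; _≗_; refl; sym; trans; cong; subst; subst₂; isEquivalence)
open import Relation.Nullary using (Dec; yes; no; does; ¬_; ¬?; contradiction)
open import Relation.Nullary.Decidable using (map′; _×-dec_; _⊎-dec_; _→-dec_)
import Relation.Unary as Unary

private
  variable
    ℓ : Level
    n m : ℕ

IsMinimum : (ℕ → Set ℓ) → ℕ → Set ℓ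
IsMinimum P m = P m × (∀ k → P k → m ≤ k)

IsMaximum : (ℕ → Set ℓ) → ℕ → Set ℓ
IsMaximum P m = P m × (∀ k → P k → k ≤ m)

minimum : {P : ℕ → Set ℓ} → Unary.Decidable P → (w : ℕ) → P w → ∃ (IsMinimum P)
minimum P? zero p = zero , p , λ _ _ → z≤n
minimum {P = P} P? (suc w) p with P? zero
... | yes p₀ = zero , p₀ , λ _ _ → z≤n
... | no ¬p₀ with minimum {P = P ∘ suc} (P? ∘ suc) w p
...   | m , pm , least = suc m , pm , least′
  where
  least′ : ∀ k → P k → suc m ≤ k
  least′ zero    q = contradiction q ¬p₀
  least′ (suc k) q = s≤s (least k q)

maximum : {P : ℕ → Set ℓ} → Unary.Decidable P → P 0 →
          (b : ℕ) → (∀ k → P k → k ≤ b) → ∃ (IsMaximum P)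
maximum P? p₀ zero bound = zero , p₀ , bound
maximum {P = P} P? p₀ (suc b) bound with P? (suc b)
... | yes p = suc b , p , bound
... | no ¬p = maximum P? p₀ b bound′
  where
  bound′ : ∀ k → P k → k ≤ b
  bound′ k q = ℕ.≤-pred (ℕ.≤∧≢⇒< (bound k q) λ { refl → ¬p q })

subset : {P : Fin n → Set} → Unary.Decidable P → Subset n
subset P? = tabulate (does ∘ P?)

module _ {P : Fin n → Set} (P? : Unary.Decidable P) where

  ∈-subset⁺ : ∀ {x} → P x → x ∈ subset P?
  ∈-subset⁺ {x} px = lookup⇒[]= x _ (trans (lookup∘tabulate (does ∘ P?) x) eq)
    where
    eq : does (P? x) ≡ true
    eq with P? x
    ... | yes _  = refl
    ... | no ¬px = contradiction px ¬px

  ∈-subset⁻ : ∀ {x} → x ∈ subset P? → P x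
  ∈-subset⁻ {x} x∈ with P? x | trans (sym (lookup∘tabulate (does ∘ P?) x)) ([]=⇒lookup x∈)
  ... | yes px | _ = px

∣subset∣-mono : {P Q : Fin n → Set} (P? : Unary.Decidable P) (Q? : Unary.Decidable Q) →
                (∀ x → P x → Q x) → ∣ subset P? ∣ ≤ ∣ subset Q? ∣
∣subset∣-mono P? Q? P⇒Q = p⊆q⇒∣p∣≤∣q∣ λ x∈ → ∈-subset⁺ Q? (P⇒Q _ (∈-subset⁻ P? x∈))

Searchable : Set → Set₁
Searchable A = {P : A → Set} → Unary.Decidable P → Dec (∃ P)

anyVec? : {A : Set} → Searchable A → ∀ m → Searchable (Vec A m)
anyVec? any zero P? = map′ ([] ,_) (λ { ([] , p) → p }) (P? [])
anyVec? any (suc m) P? =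
  map′ (λ { (x , xs , p) → x ∷ xs , p }) (λ { (x ∷ xs , p) → x , xs , p })
       (any λ x → anyVec? any m λ xs → P? (x ∷ xs))

anyBool? : Searchable Bool
anyBool? P? =
  map′ (λ { (inj₁ p) → Bool.true , p ; (inj₂ p) → Bool.false , p })
       (λ { (Bool.true , p) → inj₁ p ; (Bool.false , p) → inj₂ p })
       (P? Bool.true ⊎-dec P? Bool.false)

anyFunction? : {P : (Fin m → Fin n) → Set} → (∀ {f g} → f ≗ g → P f → P g) →
               Unary.Decidable P → Dec (∃ P)
anyFunction? {m = m} resp P? =
  map′ (λ { (xs , p) → lookup xs , p })
       (λ { (f , p) → tabulate f , resp (λ i → sym (lookup∘tabulate f i)) p })
       (anyVec? any? m (P? ∘ lookup))

injective? : (f : Fin m → Fin n) → Dec (Injective _≡_ _≡_ f)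
injective? f =
  map′ (λ h {x} {y} → h x y) (λ h x y → h {x} {y})
       (all? λ x → all? λ y → (f x ≟ f y) →-dec (x ≟ y))

injective-resp : {f g : Fin m → Fin n} → f ≗ g → Injective _≡_ _≡_ f → Injective _≡_ _≡_ g
injective-resp f≗g inj {x} {y} gx≡gy = inj (trans (f≗g x) (trans gx≡gy (sym (f≗g y))))

record Graph (n : ℕ) : Set₁ where
  field
    Adj        : Rel (Fin n) 0ℓ
    adj?       : Decidable Adj
    adj-sym    : Symmetric Adj
    adj-irrefl : ∀ {v} → ¬ Adj v v

open Graph

HasEdge : Graph n → Set
HasEdge G = ∃ λ u → ∃ λ v → Adj G u v

IsSubgraph : Graph m → Graph n → Set
IsSubgraph {m} {n} H G = ∃ λ (f : Fin m → Fin n) →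
  Injective _≡_ _≡_ f × (∀ i j → Adj H i j → Adj G (f i) (f j))

isSubgraph? : (H : Graph m) (G : Graph n) → Dec (IsSubgraph H G)
isSubgraph? H G = anyFunction?
  (λ { f≗g (inj , hom) → injective-resp f≗g inj ,
         λ i j e → subst₂ (Adj G) (f≗g i) (f≗g j) (hom i j e) })
  (λ f → injective? f ×-dec
         (all? λ i → all? λ j → adj? H i j →-dec adj? G (f i) (f j)))

-- The sides of K s t are {0,…,s-1} and {s,…,s+t-1}.
K : (s t : ℕ) → Graph (s + t)
K s t = record
  { Adj        = λ i j → (toℕ i < s × s ≤ toℕ j) ⊎ (toℕ j < s × s ≤ toℕ i)
  ; adj?       = λ i j → ((toℕ i ℕ.<? s) ×-dec (s ℕ.≤? toℕ j)) ⊎-dec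
                         ((toℕ j ℕ.<? s) ×-dec (s ℕ.≤? toℕ i))
  ; adj-sym    = Sum.swap
  ; adj-irrefl = λ { (inj₁ (p , q)) → ℕ.<⇒≱ p q ; (inj₂ (p , q)) → ℕ.<⇒≱ p q }
  }

biclique : (G : Graph n) → ∃ (IsMaximum λ s → IsSubgraph (K s s) G)
biclique {n} G = maximum (λ s → isSubgraph? (K s s) G)
  ((λ ()) , (λ { {()} }) , λ ())
  n (λ s → λ { (f , inj , _) → ℕ.≤-trans (ℕ.m≤m+n s s) (injective⇒≤ inj) })

ω̄ : Graph n → ℕ
ω̄ G = proj₁ (biclique G)

ω̄-isMaximum : (G : Graph n) → IsMaximum (λ s → IsSubgraph (K s s) G) (ω̄ G)
ω̄-isMaximum G = proj₂ (biclique G)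

data Colour : Set where
  none black red : Colour

red? : (c : Colour) → Dec (c ≡ red)
red? none  = no λ ()
red? black = no λ ()
red? red   = yes refl

record Trigraph (n : ℕ) : Set where
  field
    colour      : Fin n → Fin n → Colour
    colour-sym  : ∀ u v → colour u v ≡ colour v u
    colour-loop : ∀ v → colour v v ≡ none

open Trigraph

module _ (G : Graph n) where

  edgeColour : Fin n → Fin n → Colour
  edgeColour u v with adj? G u v
  ... | yes _ = black
  ... | no _  = none

  edgeColour-sym : ∀ u v → edgeColour u v ≡ edgeColour v u
  edgeColour-sym u v with adj? G u v | adj? G v u
  ... | yes _ | yes _ = refl
  ... | no _  | no _  = refl
  ... | yes p | no ¬p = contradiction (adj-sym G p) ¬p
  ... | no ¬p | yes p = contradiction (adj-sym G p) ¬p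

  edgeColour-loop : ∀ v → edgeColour v v ≡ none
  edgeColour-loop v with adj? G v v
  ... | yes p = ⊥-elim (adj-irrefl G p)
  ... | no _  = refl

  toTrigraph : Trigraph n
  toTrigraph = record
    { colour      = edgeColour
    ; colour-sym  = edgeColour-sym
    ; colour-loop = edgeColour-loop
    }

redDegree : Trigraph n → Fin n → ℕ
redDegree T v = ∣ subset (λ w → red? (colour T v w)) ∣

redDegree≤n : (T : Trigraph n) (v : Fin n) → redDegree T v ≤ n
redDegree≤n T v = ∣p∣≤n (subset λ w → red? (colour T v w))

MaxRedDegree≤ : ℕ → Trigraph n → Set
MaxRedDegree≤ d T = ∀ v → redDegree T v ≤ d

merge : Colour → Colour → Colour
merge none  none  = none
merge black black = black
merge _     _     = red

-- The vertices of the contraction are those of T other than y, numbered by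
-- punchIn y; the vertex x plays the role of the new vertex z.
module _ (T : Trigraph (suc n)) (x y : Fin (suc n)) where

  contractColour : Fin (suc n) → Fin (suc n) → Colour
  contractColour u v with u ≟ x | v ≟ x
  ... | yes _ | yes _ = none
  ... | yes _ | no _  = merge (colour T x v) (colour T y v)
  ... | no _  | yes _ = merge (colour T x u) (colour T y u)
  ... | no _  | no _  = colour T u v

  contractColour-sym : ∀ u v → contractColour u v ≡ contractColour v u
  contractColour-sym u v with u ≟ x | v ≟ x
  ... | yes _ | yes _ = refl
  ... | yes _ | no _  = refl
  ... | no _  | yes _ = refl
  ... | no _  | no _  = colour-sym T u v

  contractColour-loop : ∀ v → contractColour v v ≡ none
  contractColour-loop v with v ≟ x
  ... | yes _ = refl
  ... | no _  = colour-loop T v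

  contract : Trigraph n
  contract = record
    { colour      = λ u v → contractColour (punchIn y u) (punchIn y v)
    ; colour-sym  = λ u v → contractColour-sym (punchIn y u) (punchIn y v)
    ; colour-loop = λ v → contractColour-loop (punchIn y v)
    }

data ContractionSequence (d : ℕ) : {n : ℕ} → Trigraph n → Set where
  stop : {T : Trigraph 1} → MaxRedDegree≤ d T → ContractionSequence d T
  step : {T : Trigraph (2 + n)} → MaxRedDegree≤ d T →
         (x y : Fin (2 + n)) → x ≢ y →
         ContractionSequence d (contract T x y) → ContractionSequence d T

maxRedDegree≤? : ∀ d (T : Trigraph n) → Dec (MaxRedDegree≤ d T)
maxRedDegree≤? d T = all? λ v → redDegree T v ℕ.≤? d

contractionSequence? : ∀ d (T : Trigraph n) → Dec (ContractionSequence d T)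
contractionSequence? {zero} d T = no λ ()
contractionSequence? {suc zero} d T = map′ stop (λ { (stop h) → h }) (maxRedDegree≤? d T)
contractionSequence? {suc (suc n)} d T =
  map′ (λ { (h , x , y , x≢y , s) → step h x y x≢y s })
       (λ { (step h x y x≢y s) → h , x , y , x≢y , s })
       (maxRedDegree≤? d T ×-dec any? λ x → any? λ y →
          ¬? (x ≟ y) ×-dec contractionSequence? d (contract T x y))

trivialSequence : ∀ d (T : Trigraph (suc n)) → suc n ≤ d → ContractionSequence d T
trivialSequence {zero}  d T n≤d = stop λ v → ℕ.≤-trans (redDegree≤n T v) n≤d
trivialSequence {suc n} d T n≤d =
  step (λ v → ℕ.≤-trans (redDegree≤n T v) n≤d) zero (suc zero) (λ ())
       (trivialSequence d _ (ℕ.<⇒≤ n≤d))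

twinWidth : (G : Graph (suc n)) → ∃ (IsMinimum λ d → ContractionSequence d (toTrigraph G))
twinWidth {n} G = minimum (λ d → contractionSequence? d (toTrigraph G))
  (suc n) (trivialSequence (suc n) _ ℕ.≤-refl)

-- The graph without vertices has no contraction sequence; the value 0 there is
-- a convention.
tww : Graph n → ℕ
tww {zero}  G = 0
tww {suc n} G = proj₁ (twinWidth G)

tww-isMinimum : (G : Graph (suc n)) →
                IsMinimum (λ d → ContractionSequence d (toTrigraph G)) (tww G)
tww-isMinimum G = proj₂ (twinWidth G)

record LinearOrder (n : ℕ) : Set₁ where
  infix 4 _≤ᴸ_ _<ᴸ_
  field
    _≤ᴸ_            : Rel (Fin n) 0ℓ
    isDecTotalOrder : IsDecTotalOrder _≡_ _≤ᴸ_

  open IsDecTotalOrder isDecTotalOrder public using (isTotalOrder; _≤?_)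

  _<ᴸ_ : Rel (Fin n) 0ℓ
  x <ᴸ y = x ≤ᴸ y × x ≢ y

-- A path of length k, given by its k + 1 vertices.
record IsPath (G : Graph n) {k : ℕ} (p : Fin (suc k) → Fin n) : Set where
  constructor isPath
  field
    distinct : Injective _≡_ _≡_ p
    adjacent : (i : Fin k) → Adj G (p (inject₁ i)) (p (suc i))

isPath? : (G : Graph n) {k : ℕ} (p : Fin (suc k) → Fin n) → Dec (IsPath G p)
isPath? G p with injective? p | all? (λ i → adj? G (p (inject₁ i)) (p (suc i)))
... | yes inj | yes adj = yes (isPath inj adj)
... | no ¬inj | _       = no λ path → ¬inj (IsPath.distinct path)
... | yes _   | no ¬adj = no λ path → ¬adj (IsPath.adjacent path)

module _ (G : Graph n) (L : LinearOrder n) where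
  open LinearOrder L

  InnerAbove : Fin n → ∀ {k} → (Fin (suc k) → Fin n) → Set
  InnerAbove v {k} p = ∀ i → 0 < toℕ i → toℕ i < k → v <ᴸ p i

  StrongPath : Fin n → Fin n → ∀ {k} → (Fin (suc k) → Fin n) → Set
  StrongPath v u {k} p = IsPath G p × p zero ≡ v × p (fromℕ k) ≡ u × InnerAbove v p

  StronglyReachable : ℕ → Fin n → Fin n → Set
  StronglyReachable r v u = u ≤ᴸ v ×
    ∃ λ k → k ≤ r × ∃ λ (p : Fin (suc k) → Fin n) → StrongPath v u p

  strongPath? : ∀ v u {k} (p : Fin (suc k) → Fin n) → Dec (StrongPath v u p)
  strongPath? v u {k} p =
    isPath? G p ×-dec (p zero ≟ v) ×-dec (p (fromℕ k) ≟ u) ×-dec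
    all? λ i → (0 ℕ.<? toℕ i) →-dec (toℕ i ℕ.<? k) →-dec
               ((v ≤? p i) ×-dec ¬? (v ≟ p i))

  strongPath-resp : ∀ {v u k} {p q : Fin (suc k) → Fin n} →
                    p ≗ q → StrongPath v u p → StrongPath v u q
  strongPath-resp {v} {k = k} p≗q (isPath inj adj , start , end , inner) =
    isPath (injective-resp p≗q inj)
           (λ i → subst₂ (Adj G) (p≗q (inject₁ i)) (p≗q (suc i)) (adj i)) ,
    trans (sym (p≗q zero)) start ,
    trans (sym (p≗q (fromℕ k))) end ,
    λ i 0<i i<k → subst (v <ᴸ_) (p≗q i) (inner i 0<i i<k)

  stronglyReachable? : ∀ r v → Unary.Decidable (StronglyReachable r v)
  stronglyReachable? r v u = (u ≤? v) ×-dec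
    map′ (λ { (k , s≤s k≤r , h) → k , k≤r , h }) (λ { (k , k≤r , h) → k , s≤s k≤r , h })
         (ℕ.anyUpTo? (λ k → anyFunction? strongPath-resp (strongPath? v u)) (suc r))

  Sreach : ℕ → Fin n → Subset n
  Sreach r v = subset (stronglyReachable? r v)

  -- The default 0 is attained only when there are no vertices.
  maxSreach : ℕ → ℕ
  maxSreach r = Extrema.max 0 (List.tabulate λ v → ∣ Sreach r v ∣)

-- Every linear order agrees with one given by a Boolean matrix, so the
-- minimum over all orders can be found by search.

module _ (G : Graph n) (L L′ : LinearOrder n) where
  private
    module L  = LinearOrder L
    module L′ = LinearOrder L′

  Agree : Set
  Agree = ∀ x y → (x L.≤ᴸ y → x L′.≤ᴸ y) × (x L′.≤ᴸ y → x L.≤ᴸ y)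

  stronglyReachable-mono : Agree → ∀ r v u →
    StronglyReachable G L r v u → StronglyReachable G L′ r v u
  stronglyReachable-mono ag r v u (u≤v , k , k≤r , p , path , start , end , inner) =
    proj₁ (ag u v) u≤v , k , k≤r , p , path , start , end ,
    λ i 0<i i<k → let (v≤ , v≢) = inner i 0<i i<k in proj₁ (ag v (p i)) v≤ , v≢

maxSreach-cong : (G : Graph n) (L L′ : LinearOrder n) → Agree G L L′ →
                 ∀ r → maxSreach G L r ≡ maxSreach G L′ r
maxSreach-cong G L L′ ag r = cong (Extrema.max 0) (List.tabulate-cong λ v →
  ℕ.≤-antisym
    (∣subset∣-mono (stronglyReachable? G L r v) (stronglyReachable? G L′ r v)
      (stronglyReachable-mono G L L′ ag r v))
    (∣subset∣-mono (stronglyReachable? G L′ r v) (stronglyReachable? G L r v)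
      (stronglyReachable-mono G L′ L (λ x y → proj₂ (ag x y) , proj₁ (ag x y)) r v)))

Matrix : ℕ → Set
Matrix n = Vec (Vec Bool n) n

Rel[_] : Matrix n → Rel (Fin n) 0ℓ
Rel[ M ] x y = T (lookup (lookup M x) y)

rel? : (M : Matrix n) → Decidable Rel[ M ]
rel? M x y = Bool.T? (lookup (lookup M x) y)

isTotalOrder? : {R : Rel (Fin n) 0ℓ} → Decidable R → Dec (IsTotalOrder _≡_ R)
isTotalOrder? {R = R} R? =
  map′ (λ { (rfl , trn , asym , tot) → record
              { isPartialOrder = record
                { isPreorder = record
                  { isEquivalence = isEquivalence
                  ; reflexive     = λ { {x} refl → rfl x }
                  ; trans         = λ {x} {y} {z} → trn x y z
                  }
                ; antisym = λ {x} {y} → asym x y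
                }
              ; total = tot
              } })
       (λ O → let module O = IsTotalOrder O in
              (λ _ → O.refl) , (λ _ _ _ → O.trans) , (λ _ _ → O.antisym) , O.total)
       ((all? λ x → R? x x) ×-dec
        (all? λ x → all? λ y → all? λ z → R? x y →-dec R? y z →-dec R? x z) ×-dec
        (all? λ x → all? λ y → R? x y →-dec R? y x →-dec (x ≟ y)) ×-dec
        (all? λ x → all? λ y → R? x y ⊎-dec R? y x))

fromMatrix : (M : Matrix n) → IsTotalOrder _≡_ Rel[ M ] → LinearOrder n
fromMatrix M O = record
  { _≤ᴸ_            = Rel[ M ]
  ; isDecTotalOrder = record { isTotalOrder = O ; _≟_ = _≟_ ; _≤?_ = rel? M }
  }

T-does⁺ : {A : Set} (a? : Dec A) → A → T (does a?)
T-does⁺ (yes _) a = _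
T-does⁺ (no ¬a) a = ¬a a

T-does⁻ : {A : Set} (a? : Dec A) → T (does a?) → A
T-does⁻ (yes a) _ = a

module _ (L : LinearOrder n) where
  open LinearOrder L

  toMatrix : Matrix n
  toMatrix = tabulate λ x → tabulate λ y → does (x ≤? y)

  private
    entry : ∀ x y → lookup (lookup toMatrix x) y ≡ does (x ≤? y)
    entry x y = trans (cong (λ row → lookup row y) (lookup∘tabulate _ x)) (lookup∘tabulate _ y)

  toMatrix⁺ : ∀ {x y} → x ≤ᴸ y → Rel[ toMatrix ] x y
  toMatrix⁺ {x} {y} h = subst T (sym (entry x y)) (T-does⁺ (x ≤? y) h)

  toMatrix⁻ : ∀ {x y} → Rel[ toMatrix ] x y → x ≤ᴸ y
  toMatrix⁻ {x} {y} h = T-does⁻ (x ≤? y) (subst T (entry x y) h)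

  toMatrix-isTotalOrder : IsTotalOrder _≡_ Rel[ toMatrix ]
  toMatrix-isTotalOrder = record
    { isPartialOrder = record
      { isPreorder = record
        { isEquivalence = isEquivalence
        ; reflexive     = λ eq → toMatrix⁺ (O.reflexive eq)
        ; trans         = λ a b → toMatrix⁺ (O.trans (toMatrix⁻ a) (toMatrix⁻ b))
        }
      ; antisym = λ a b → O.antisym (toMatrix⁻ a) (toMatrix⁻ b)
      }
    ; total = λ x y → Sum.map toMatrix⁺ toMatrix⁺ (O.total x y)
    }
    where module O = IsTotalOrder isTotalOrder

IsMaxSreach : Graph n → ℕ → ℕ → Set₁
IsMaxSreach {n} G r k = ∃ λ (L : LinearOrder n) → maxSreach G L r ≡ k

isMaxSreach? : (G : Graph n) (r : ℕ) → Unary.Decidable (IsMaxSreach G r)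
isMaxSreach? {n} G r k =
  map′ (λ { (M , O , eq) → fromMatrix M O , eq })
       (λ { (L , eq) → toMatrix L , toMatrix-isTotalOrder L ,
              trans (maxSreach-cong G (fromMatrix (toMatrix L) (toMatrix-isTotalOrder L)) L
                                    (λ x y → toMatrix⁻ L , toMatrix⁺ L) r) eq })
       (anyVec? (anyVec? anyBool? n) n search?)
  where
  search? : Unary.Decidable λ M → Σ (IsTotalOrder _≡_ Rel[ M ]) λ O →
                                  maxSreach G (fromMatrix M O) r ≡ k
  search? M with isTotalOrder? (rel? M)
  ... | no ¬O = no λ { (O , _) → ¬O O }
  ... | yes O = map′ (O ,_)
    (λ { (O′ , eq) → trans (maxSreach-cong G (fromMatrix M O) (fromMatrix M O′) (λ x y → id , id) r) eq })
    (maxSreach G (fromMatrix M O) r ℕ.≟ k)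

naturalOrder : LinearOrder n
naturalOrder = record { isDecTotalOrder = Data.Fin.Properties.≤-isDecTotalOrder }

strongColouring : (G : Graph n) (r : ℕ) → ∃ (IsMinimum (IsMaxSreach G r))
strongColouring G r = minimum (isMaxSreach? G r) _ (naturalOrder , refl)

scol : ℕ → Graph n → ℕ
scol r G = proj₁ (strongColouring G r)

scol-isMinimum : (G : Graph n) (r : ℕ) → IsMinimum (IsMaxSreach G r) (scol r G)
scol-isMinimum G r = proj₂ (strongColouring G r)

∑< : ℕ → (ℕ → ℤ) → ℤ
∑< zero    f = 0ℤ
∑< (suc n) f = ∑< n f ℤ.+ f n

syntax ∑< n (λ i → e) = ∑[ i < n ] e

{-# OPTIONS --safe #-}

-- Let s = ω̄(G), and call a part of a trigraph of the contraction sequence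
-- large if it has more than s vertices of G.  At most s vertices of G lie in
-- parts joined by black edges to a given large part, as otherwise G would
-- contain K_{s+1,s+1}; in particular, edges between large parts are red.
--
-- Order the vertices of G by the time at which their part becomes large, with
-- later vertices smaller in the order.  When v becomes large, as a member of
-- the new part Z, all inner vertices of a strong path from v lie in large
-- parts, and an endpoint u outside Z lies in a small part.  So the path follows
-- red edges from Z, up to its last edge, which is black or red.  Hence u is
-- one of: at most 2s vertices of Z (Z merges two parts, and only the vertices
-- of the small ones count); at most s vertices in black neighbours of Z; or a
-- vertex charged to a part W ≠ Z at red distance at most r from Z, where W is
-- charged at most s vertices: its own if it is small, and those of its black
-- neighbours if it is large.
module Submission where

open import Defs
open import Data.Bool using (true; false)
open import Data.Fin using (Fin; zero; suc; toℕ; fromℕ; inject₁; inject≤; punchIn; punchOut; splitAt; join)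
open import Data.Fin.Properties using (_≟_; toℕ-injective; toℕ<n; injective⇒≤; inject≤-injective; join-splitAt; splitAt-<; splitAt-≥; punchIn-punchOut; punchIn-injective)
open import Data.Fin.Subset using (∣_∣)
open import Data.Integer as ℤ using (+_; _+_; _-_; _*_; _^_; _≤_)
import Data.Integer.Properties as ℤ
open import Data.List as List using (List; []; _∷_; _++_; length; filter; map; concatMap; lookup; allFin)
import Data.List.Extrema.Nat as Extrema
open import Data.List.Membership.Propositional using (_∈_; find; lose)
open import Data.List.Membership.Propositional.Properties using (∈-filter⁺; ∈-filter⁻; ∈-allFin; ∈-lookup; ∈-map⁺; ∈-map⁻; ∈-++⁺ˡ; ∈-++⁺ʳ; ∈-concatMap⁺; ∈-concatMap⁻)
open import Data.List.Properties using (length-++; length-map; length-tabulate; filter-notAll)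
open import Data.List.Relation.Unary.All as All using ([])
import Data.List.Relation.Unary.All.Properties as All
open import Data.List.Relation.Unary.AllPairs using ([]; _∷_)
open import Data.List.Relation.Unary.Any as Any using (here; there)
open import Data.List.Relation.Unary.Any.Properties using (lookup-index)
open import Data.List.Relation.Unary.Unique.Propositional using (Unique)
import Data.List.Relation.Unary.Unique.Propositional.Properties as Unique
open import Data.Nat as ℕ using (ℕ; zero; suc; z≤n; s≤s; _∸_)
import Data.Nat.Properties as ℕ
open import Data.Product using (∃; _×_; _,_; proj₁; proj₂)
open import Data.Sum using (_⊎_; inj₁; inj₂; [_,_]′)
import Data.Vec as Vec
open import Function using (_∘_; id)
open import Function.Definitions using (Injective)
open import Relation.Binary.PropositionalEquality using (_≡_; _≢_; refl; sym; trans; cong; cong₂; subst; subst₂; module ≡-Reasoning; isEquivalence)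
open import Relation.Nullary using (Dec; yes; no; does; ¬_; ¬?; contradiction)
open import Relation.Nullary.Decidable using (_×-dec_)
import Relation.Unary as Unary

open Graph
open Trigraph

private
  variable
    n m : ℕ
    A B : Set

-- Counting with lists

lookup-injective : {xs : List A} → Unique xs → Injective _≡_ _≡_ (lookup xs)
lookup-injective (_ ∷ _)  {zero}  {zero}  _  = refl
lookup-injective (x∉ ∷ _) {zero}  {suc j} eq = contradiction eq (All.lookup x∉ (∈-lookup j))
lookup-injective (x∉ ∷ _) {suc i} {zero}  eq = contradiction (sym eq) (All.lookup x∉ (∈-lookup i))
lookup-injective (_ ∷ u)  {suc i} {suc j} eq = cong suc (lookup-injective u eq)

-- Each position of `xs` goes to a position of `ys` with the same value, which is injective once
-- `xs` has no repetitions. The covering lists used as `ys` may thus name a vertex several times.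
length-⊆ : {xs ys : List A} → Unique xs → (∀ {x} → x ∈ xs → x ∈ ys) → length xs ℕ.≤ length ys
length-⊆ {xs = xs} {ys} u xs⊆ys = injective⇒≤ {f = position} λ {i} {j} eq →
  lookup-injective u (trans (found i) (trans (cong (lookup ys) eq) (sym (found j))))
  where
  position : Fin (length xs) → Fin (length ys)
  position i = Any.index (xs⊆ys (∈-lookup i))

  found : ∀ i → lookup xs i ≡ lookup ys (position i)
  found i = lookup-index (xs⊆ys (∈-lookup i))

length-concatMap-≤ : (f : A → List B) (c : ℕ) (xs : List A) →
                     (∀ {x} → x ∈ xs → length (f x) ℕ.≤ c) →
                     length (concatMap f xs) ℕ.≤ length xs ℕ.* c
length-concatMap-≤ f c []       _ = z≤n
length-concatMap-≤ f c (x ∷ xs) h rewrite length-++ (f x) {concatMap f xs} =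
  ℕ.+-mono-≤ (h (here refl)) (length-concatMap-≤ f c xs (h ∘ there))

elements : {P : Fin n → Set} → Unary.Decidable P → List (Fin n)
elements P? = filter P? (allFin _)

module _ {P : Fin n → Set} (P? : Unary.Decidable P) where

  ∈-elements⁺ : ∀ {x} → P x → x ∈ elements P?
  ∈-elements⁺ = ∈-filter⁺ P? (∈-allFin _)

  ∈-elements⁻ : ∀ {x} → x ∈ elements P? → P x
  ∈-elements⁻ = proj₂ ∘ ∈-filter⁻ P? {xs = allFin n}

  elements-unique : Unique (elements P?)
  elements-unique = Unique.filter⁺ P? (Unique.allFin⁺ n)

  length-elements-≤ : {ys : List (Fin n)} → (∀ {x} → P x → x ∈ ys) → length (elements P?) ℕ.≤ length ys
  length-elements-≤ P⊆ys = length-⊆ elements-unique (P⊆ys ∘ ∈-elements⁻)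

-- Passes from the subset cardinalities of the definitions to list lengths. The function `f` is
-- arbitrary because the induction replaces it by `f ∘ suc`.
∣tabulate∣≡length-filter : {P : A → Set} (P? : Unary.Decidable P) (f : Fin n → A) →
                           ∣ Vec.tabulate (does ∘ P? ∘ f) ∣ ≡ length (filter P? (List.tabulate f))
∣tabulate∣≡length-filter {n = zero}  P? f = refl
∣tabulate∣≡length-filter {n = suc n} P? f with does (P? (f zero))
... | true  = cong suc (∣tabulate∣≡length-filter P? (f ∘ suc))
... | false = ∣tabulate∣≡length-filter P? (f ∘ suc)

∣subset∣≡length-elements : {P : Fin n → Set} (P? : Unary.Decidable P) →
                           ∣ subset P? ∣ ≡ length (elements P?)
∣subset∣≡length-elements P? = ∣tabulate∣≡length-filter P? id

-- Bicliques

module _ (G : Graph n) where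

  -- The two sides are disjoint by irreflexivity: a common vertex would be adjacent to itself.
  complete⇒biclique : ∀ s {xs ys : List (Fin n)} → Unique xs → Unique ys →
                      s ℕ.≤ length xs → s ℕ.≤ length ys →
                      (∀ {x y} → x ∈ xs → y ∈ ys → Adj G x y) → IsSubgraph (K s s) G
  complete⇒biclique s {xs} {ys} uxs uys s≤xs s≤ys adj = embed ∘ splitAt s , injective , hom
    where
    left : Fin s → Fin n
    left i = lookup xs (inject≤ i s≤xs)

    right : Fin s → Fin n
    right j = lookup ys (inject≤ j s≤ys)

    left-right : ∀ i j → Adj G (left i) (right j)
    left-right i j = adj (∈-lookup (inject≤ i s≤xs)) (∈-lookup (inject≤ j s≤ys))

    left≢right : ∀ i j → left i ≢ right j
    left≢right i j eq = adj-irrefl G (subst (Adj G (left i)) (sym eq) (left-right i j))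

    embed : Fin s ⊎ Fin s → Fin n
    embed = [ left , right ]′

    embed-injective : ∀ a b → embed a ≡ embed b → a ≡ b
    embed-injective (inj₁ i) (inj₁ j) eq = cong inj₁ (inject≤-injective _ _ i j (lookup-injective uxs eq))
    embed-injective (inj₂ i) (inj₂ j) eq = cong inj₂ (inject≤-injective _ _ i j (lookup-injective uys eq))
    embed-injective (inj₁ i) (inj₂ j) eq = contradiction eq (left≢right i j)
    embed-injective (inj₂ i) (inj₁ j) eq = contradiction (sym eq) (left≢right j i)

    injective : Injective _≡_ _≡_ (embed ∘ splitAt s)
    injective {i} {j} eq = trans (sym (join-splitAt s s i))
      (trans (cong (join s s) (embed-injective (splitAt s i) (splitAt s j) eq)) (join-splitAt s s j))

    hom : ∀ i j → Adj (K s s) i j → Adj G (embed (splitAt s i)) (embed (splitAt s j))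
    hom i j (inj₁ (i<s , s≤j)) rewrite splitAt-< s i i<s | splitAt-≥ s j s≤j = left-right _ _
    hom i j (inj₂ (j<s , s≤i)) rewrite splitAt-< s j j<s | splitAt-≥ s i s≤i = adj-sym G (left-right _ _)

  no-biclique⇒small : ∀ {s} {xs ys : List (Fin n)} → ¬ IsSubgraph (K (suc s) (suc s)) G →
                      Unique xs → Unique ys → s ℕ.< length xs →
                      (∀ {x y} → x ∈ xs → y ∈ ys → Adj G x y) → length ys ℕ.≤ s
  no-biclique⇒small {s} no-K uxs uys s<xs adj =
    ℕ.≮⇒≥ λ s<ys → no-K (complete⇒biclique (suc s) uxs uys s<xs s<ys adj)

  HasEdge⇒1≤ω̄ : HasEdge G → 1 ℕ.≤ ω̄ G
  HasEdge⇒1≤ω̄ (u , v , uv) = proj₂ (ω̄-isMaximum G) 1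
    (complete⇒biclique 1 {u ∷ []} {v ∷ []} ([] ∷ [])
      ([] ∷ []) ℕ.≤-refl ℕ.≤-refl
      λ { (here refl) (here refl) → uv })

  -- Ensures that the last part of a contraction sequence, all of V(G), is large. A biclique with
  -- sides of size `ω̄ G` occupies twice that many vertices, and `ω̄ G` is positive.
  ω̄<n : HasEdge G → ω̄ G ℕ.< n
  ω̄<n e = let (_ , inj , _) = proj₁ (ω̄-isMaximum G) in
    ℕ.≤-trans (ℕ.+-monoˡ-≤ (ω̄ G) (HasEdge⇒1≤ω̄ e)) (injective⇒≤ inj)

  ¬biclique : ¬ IsSubgraph (K (suc (ω̄ G)) (suc (ω̄ G))) G
  ¬biclique h = ℕ.<-irrefl refl (proj₂ (ω̄-isMaximum G) (suc (ω̄ G)) h)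

-- Red layers around a part

-- The number of vertices other than the root within distance `r` of the root of a `d`-regular tree.
treeSize : ℕ → ℕ → ℕ
treeSize d zero    = 0
treeSize d (suc r) = treeSize d r ℕ.+ d ℕ.* (d ∸ 1) ℕ.^ r

module _ (T : Trigraph m) where

  isRed? : ∀ W W′ → Dec (colour T W W′ ≡ red)
  isRed? W W′ = red? (colour T W W′)

  redNbrs : Fin m → List (Fin m)
  redNbrs W = elements (isRed? W)

  ∈-redNbrs-sym : ∀ {W W′} → W′ ∈ redNbrs W → W ∈ redNbrs W′
  ∈-redNbrs-sym {W} {W′} h =
    ∈-elements⁺ (isRed? W′) (trans (colour-sym T W′ W) (∈-elements⁻ (isRed? W) h))

  redNbrsExcept : Fin m → Fin m → List (Fin m)
  redNbrsExcept P W = filter (λ W′ → ¬? (W′ ≟ P)) (redNbrs W)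

  children : Fin m × Fin m → List (Fin m × Fin m)
  children (W , P) = map (_, W) (redNbrsExcept P W)

  -- Pairs (end, last but one) of the non-backtracking red walks from Z with
  -- i + 1 edges.
  layer : Fin m → ℕ → List (Fin m × Fin m)
  layer Z zero    = map (_, Z) (redNbrs Z)
  layer Z (suc i) = concatMap children (layer Z i)

  layers : Fin m → ℕ → List (Fin m × Fin m)
  layers Z zero    = []
  layers Z (suc r) = layers Z r ++ layer Z r

  -- Red distance at most `j`. The witness is a non-backtracking walk, so that a ball is counted by
  -- its layers.
  InBall : Fin m → ℕ → Fin m → Set
  InBall Z j W = W ≡ Z ⊎ ∃ λ i → ∃ λ P → i ℕ.< j × (W , P) ∈ layer Z i

  InBall-mono : ∀ {Z i j W} → i ℕ.≤ j → InBall Z i W → InBall Z j W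
  InBall-mono i≤j (inj₁ eq)                = inj₁ eq
  InBall-mono i≤j (inj₂ (k , P , k<i , h)) = inj₂ (k , P , ℕ.≤-trans k<i i≤j , h)

  ∈-children⁻ : ∀ {W P} e → (W , P) ∈ children e → P ≡ proj₁ e × W ∈ redNbrs P
  ∈-children⁻ (P , Q) h with ∈-map⁻ (_, P) h
  ... | _ , W∈ , refl = refl , proj₁ (∈-filter⁻ (λ W′ → ¬? (W′ ≟ Q)) {xs = redNbrs P} W∈)

  layer-parent : ∀ {Z W P} i → (W , P) ∈ layer Z i → W ∈ redNbrs P × InBall Z i P
  layer-parent {Z} zero h with ∈-map⁻ (_, Z) h
  ... | _ , W∈ , refl = W∈ , inj₁ refl
  layer-parent {Z} (suc i) h with find (∈-concatMap⁻ children {xs = layer Z i} h)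
  ... | (P , Q) , e∈ , h′ with ∈-children⁻ (P , Q) h′
  ...   | refl , W∈ = W∈ , inj₂ (i , Q , ℕ.≤-refl , e∈)

  InBall-step : ∀ {Z j W W′} → InBall Z j W → W′ ∈ redNbrs W → InBall Z (suc j) W′
  InBall-step {Z} (inj₁ refl) h = inj₂ (0 , _ , s≤s z≤n , ∈-map⁺ (_, Z) h)
  InBall-step {Z} {j} {W} {W′} (inj₂ (i , P , i<j , e∈)) h with W′ ≟ P
  -- Returning to the predecessor does not extend the walk, but the predecessor already lies in a
  -- smaller ball.
  ... | yes refl = InBall-mono (ℕ.m≤n⇒m≤1+n (ℕ.<⇒≤ i<j)) (proj₂ (layer-parent i e∈))
  ... | no W′≢P  = inj₂ (suc i , W , s≤s i<j ,
    ∈-concatMap⁺ children (lose e∈ (∈-map⁺ (_, W) (∈-filter⁺ (λ V → ¬? (V ≟ P)) h W′≢P))))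

  layer⊆layers : ∀ {Z e i r} → i ℕ.< r → e ∈ layer Z i → e ∈ layers Z r
  layer⊆layers {Z} {e} {i} {suc r} i<1+r h with i ℕ.≟ r
  ... | yes refl = ∈-++⁺ʳ (layers Z r) h
  ... | no i≢r   = ∈-++⁺ˡ (layer⊆layers (ℕ.≤∧≢⇒< (ℕ.≤-pred i<1+r) i≢r) h)

  module _ {d : ℕ} (deg : MaxRedDegree≤ d T) where

    length-redNbrs : ∀ W → length (redNbrs W) ℕ.≤ d
    length-redNbrs W = subst (ℕ._≤ d) (∣subset∣≡length-elements (isRed? W)) (deg W)

    -- The predecessor `P` is itself a red neighbour of `W`, so excluding it leaves at most `d ∸ 1`;
    -- all factors `d ∸ 1` of `treeSize` come from here.
    length-children : ∀ {W P} → P ∈ redNbrs W → length (children (W , P)) ℕ.≤ d ∸ 1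
    length-children {W} {P} P∈ rewrite length-map (_, W) (redNbrsExcept P W) = begin
      length (redNbrsExcept P W)   ≤⟨ ℕ.∸-monoˡ-≤ 1 fewer ⟩
      length (redNbrs W) ∸ 1       ≤⟨ ℕ.∸-monoˡ-≤ 1 (length-redNbrs W) ⟩
      d ∸ 1                        ∎
      where
      open ℕ.≤-Reasoning
      fewer : length (redNbrsExcept P W) ℕ.< length (redNbrs W)
      fewer = filter-notAll (λ W′ → ¬? (W′ ≟ P)) (redNbrs W) (lose P∈ λ P≢P → P≢P refl)

    length-layer : ∀ Z i → length (layer Z i) ℕ.≤ d ℕ.* (d ∸ 1) ℕ.^ i
    length-layer Z zero rewrite length-map (_, Z) (redNbrs Z) | ℕ.*-identityʳ d = length-redNbrs Z
    length-layer Z (suc i) = begin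
      length (concatMap children (layer Z i))   ≤⟨ length-concatMap-≤ children (d ∸ 1) (layer Z i)
                                                     (λ h → length-children (∈-redNbrs-sym (proj₁ (layer-parent i h)))) ⟩
      length (layer Z i) ℕ.* (d ∸ 1)            ≤⟨ ℕ.*-monoˡ-≤ (d ∸ 1) (length-layer Z i) ⟩
      d ℕ.* (d ∸ 1) ℕ.^ i ℕ.* (d ∸ 1)           ≡⟨ ℕ.*-assoc d _ _ ⟩
      d ℕ.* ((d ∸ 1) ℕ.^ i ℕ.* (d ∸ 1))         ≡⟨ cong (d ℕ.*_) (ℕ.*-comm ((d ∸ 1) ℕ.^ i) (d ∸ 1)) ⟩
      d ℕ.* (d ∸ 1) ℕ.^ suc i                   ∎
      where open ℕ.≤-Reasoning

    length-layers : ∀ Z r → length (layers Z r) ℕ.≤ treeSize d r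
    length-layers Z zero    = z≤n
    length-layers Z (suc r) rewrite length-++ (layers Z r) {layer Z r} =
      ℕ.+-mono-≤ (length-layers Z r) (length-layer Z r)

-- Partitions of V(G) underlying the trigraphs of a contraction sequence

part : (Fin n → Fin m) → Fin m → List (Fin n)
part π W = elements (λ u → π u ≟ W)

∈-part : (π : Fin n → Fin m) (u : Fin n) → u ∈ part π (π u)
∈-part π u = ∈-elements⁺ (λ w → π w ≟ π u) refl

-- The homogeneity invariant of contraction sequences: two parts joined by no red edge are complete
-- or anticomplete to each other. A red edge carries no information about `G`.
record Quotient (G : Graph n) (T : Trigraph m) (π : Fin n → Fin m) : Set where
  field
    black⇒adj : ∀ u w → colour T (π u) (π w) ≡ black → Adj G u w
    adj⇒edge  : ∀ u w → Adj G u w → π u ≢ π w → colour T (π u) (π w) ≢ none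

open Quotient

module Large (s : ℕ) where

  Large : (Fin n → Fin m) → Fin m → Set
  Large π W = s ℕ.< length (part π W)

  large? : (π : Fin n → Fin m) → Unary.Decidable (Large π)
  large? π W = s ℕ.<? length (part π W)

black? : (c : Colour) → Dec (c ≡ black)
black? none  = no λ ()
black? black = yes refl
black? red   = no λ ()

-- Black neighbours, charges and walks around a large part

module _ (G : Graph n) {s : ℕ} (no-K : ¬ IsSubgraph (K (suc s) (suc s)) G)
         {T : Trigraph m} {π : Fin n → Fin m} (Q : Quotient G T π) where
  open Large s

  isBlack? : ∀ W W′ → Dec (colour T W W′ ≡ black)
  isBlack? W W′ = black? (colour T W W′)

  blackNbrs : Fin m → List (Fin n)
  blackNbrs W = elements (λ u → isBlack? W (π u))

  length-blackNbrs : ∀ {W} → Large π W → length (blackNbrs W) ℕ.≤ s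
  length-blackNbrs {W} large = no-biclique⇒small G no-K
    (elements-unique (λ u → π u ≟ W)) (elements-unique (λ u → isBlack? W (π u))) large
    λ {x} {y} x∈ y∈ → black⇒adj Q x y
      (subst (λ V → colour T V (π y) ≡ black) (sym (∈-elements⁻ (λ u → π u ≟ W) x∈))
             (∈-elements⁻ (λ u → isBlack? W (π u)) y∈))

  large-large⇒¬black : ∀ {W W′} → Large π W → Large π W′ → colour T W W′ ≢ black
  large-large⇒¬black {W} {W′} large large′ eq = ℕ.<⇒≱ large′
    (ℕ.≤-trans (length-elements-≤ (λ u → π u ≟ W′) {ys = blackNbrs W}
                 (λ { refl → ∈-elements⁺ (λ u → isBlack? W (π u)) eq }))
               (length-blackNbrs large))

  data EdgeView (u w : Fin n) : Set where
    inside   : π u ≡ π w → EdgeView u w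
    viaBlack : colour T (π u) (π w) ≡ black → EdgeView u w
    viaRed   : colour T (π u) (π w) ≡ red → EdgeView u w

  edgeView : ∀ {u w} → Adj G u w → EdgeView u w
  edgeView {u} {w} uw with π u ≟ π w | colour T (π u) (π w) in eq
  ... | yes p | _     = inside p
  ... | no ¬p | none  = contradiction eq (adj⇒edge Q u w uw ¬p)
  ... | no ¬p | black = viaBlack eq
  ... | no ¬p | red   = viaRed eq

  -- The two cases match the colour of the last edge of a strong path: after a black edge the
  -- endpoint is charged to the large part before it, after a red edge to its own small part.
  charge : Fin m → List (Fin n)
  charge W with large? π W
  ... | yes _ = blackNbrs W
  ... | no _  = part π W

  length-charge : ∀ W → length (charge W) ℕ.≤ s
  length-charge W with large? π W
  ... | yes large = length-blackNbrs large
  ... | no small  = ℕ.≮⇒≥ small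

  blackNbrs⊆charge : ∀ {W u} → Large π W → u ∈ blackNbrs W → u ∈ charge W
  blackNbrs⊆charge {W} large u∈ with large? π W
  ... | yes _    = u∈
  ... | no small = contradiction large small

  part⊆charge : ∀ {W u} → ¬ Large π W → u ∈ part π W → u ∈ charge W
  part⊆charge {W} small u∈ with large? π W
  ... | yes large = contradiction large small
  ... | no _      = u∈

  module _ (Z : Fin m) (large-Z : Large π Z) (r : ℕ) where

    -- The layers start at red distance 1, so the black neighbours of `Z` itself are listed
    -- separately; they account for one `s` in the final bound.
    outside : List (Fin n)
    outside = blackNbrs Z ++ concatMap (charge ∘ proj₁) (layers T Z r)

    charge⊆outside : ∀ {W u} → W ≢ Z → InBall T Z r W → u ∈ charge W → u ∈ outside
    charge⊆outside W≢Z (inj₁ W≡Z)              u∈ = contradiction W≡Z W≢Z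
    charge⊆outside W≢Z (inj₂ (i , P , i<r , e∈)) u∈ = ∈-++⁺ʳ (blackNbrs Z)
      (∈-concatMap⁺ (charge ∘ proj₁) (lose (layer⊆layers T i<r e∈) u∈))

    blackNbrs⊆outside : ∀ {W u} → InBall T Z r W → Large π W → u ∈ blackNbrs W → u ∈ outside
    blackNbrs⊆outside {W} W∈ large u∈ with W ≟ Z
    ... | yes refl = ∈-++⁺ˡ u∈
    ... | no W≢Z   = charge⊆outside W≢Z W∈ (blackNbrs⊆charge large u∈)

    -- Induction on the number `suc k` of remaining edges, where `j` bounds the red distance from
    -- `Z` to the current part. An edge between large parts is not black, so each step stays inside
    -- a part or follows a red edge, and `j` grows by at most one. Only the last edge leads to a
    -- small part.
    walk⊆outside : ∀ k {j} (p : Fin (2 ℕ.+ k) → Fin n) →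
                   (∀ i → Adj G (p (inject₁ i)) (p (suc i))) →
                   (∀ i → toℕ i ℕ.≤ k → Large π (π (p i))) →
                   InBall T Z j (π (p zero)) → j ℕ.+ suc k ℕ.≤ r →
                   let u = p (fromℕ (suc k)) in
                   ¬ Large π (π u) → π u ≢ Z → u ∈ outside
    walk⊆outside zero {j} p adj large p₀∈ j+1≤r small u∉Z with edgeView (adj zero)
    ... | inside eq   = contradiction (subst (Large π) eq (large zero z≤n)) small
    ... | viaBlack eq = blackNbrs⊆outside (InBall-mono T (ℕ.m+n≤o⇒m≤o j j+1≤r) p₀∈) (large zero z≤n)
                        (∈-elements⁺ (λ u → isBlack? (π (p zero)) (π u)) eq)
    ... | viaRed eq   = charge⊆outside u∉Z
                        (InBall-mono T (subst (ℕ._≤ r) (ℕ.+-comm j 1) j+1≤r)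
                          (InBall-step T p₀∈ (∈-elements⁺ (isRed? T (π (p zero))) eq)))
                        (part⊆charge small (∈-part π _))
    walk⊆outside (suc k) {j} p adj large p₀∈ j+k≤r =
      walk⊆outside k {suc j} (p ∘ suc) (adj ∘ suc) (λ i i≤k → large (suc i) (s≤s i≤k))
        p₁∈ (subst (ℕ._≤ r) (ℕ.+-suc j (suc k)) j+k≤r)
      where
      p₁∈ : InBall T Z (suc j) (π (p (suc zero)))
      p₁∈ with edgeView (adj zero)
      ... | inside eq   = InBall-mono T (ℕ.n≤1+n j) (subst (InBall T Z j) eq p₀∈)
      ... | viaBlack eq = contradiction eq
                          (large-large⇒¬black (large zero z≤n) (large (suc zero) (s≤s z≤n)))
      ... | viaRed eq   = InBall-step T p₀∈ (∈-elements⁺ (isRed? T (π (p zero))) eq)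

    length-outside : ∀ {d} → MaxRedDegree≤ d T → length outside ℕ.≤ s ℕ.+ treeSize d r ℕ.* s
    length-outside deg rewrite length-++ (blackNbrs Z) {concatMap (charge ∘ proj₁) (layers T Z r)} =
      ℕ.+-mono-≤ (length-blackNbrs large-Z)
        (ℕ.≤-trans (length-concatMap-≤ (charge ∘ proj₁) s (layers T Z r) (λ {e} _ → length-charge (proj₁ e)))
                   (ℕ.*-monoˡ-≤ s (length-layers T deg Z r)))

-- The effect of one contraction on the partition

merge-≢red : ∀ {c} c₁ c₂ → c ≢ red → merge c₁ c₂ ≡ c → c₁ ≡ c × c₂ ≡ c
merge-≢red none  none  _ refl = refl , refl
merge-≢red black black _ refl = refl , refl
merge-≢red none  black c≢red refl = contradiction refl c≢red
merge-≢red none  red   c≢red refl = contradiction refl c≢red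
merge-≢red black none  c≢red refl = contradiction refl c≢red
merge-≢red black red   c≢red refl = contradiction refl c≢red
merge-≢red red   c₂    c≢red refl = contradiction refl c≢red

module _ (T : Trigraph (suc m)) (x y : Fin (suc m)) where

  contractColour-merged : ∀ {v} → v ≢ x → contractColour T x y x v ≡ merge (colour T x v) (colour T y v)
  contractColour-merged {v} v≢x with x ≟ x | v ≟ x
  ... | _      | yes v≡x = contradiction v≡x v≢x
  ... | yes _  | no _    = refl
  ... | no x≢x | no _    = contradiction refl x≢x

  contractColour-kept : ∀ {u v} → u ≢ x → v ≢ x → contractColour T x y u v ≡ colour T u v
  contractColour-kept {u} {v} u≢x v≢x with u ≟ x | v ≟ x
  ... | yes u≡x | _       = contradiction u≡x u≢x
  ... | no _    | yes v≡x = contradiction v≡x v≢x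
  ... | no _    | no _    = refl

module _ {x y : Fin (suc m)} (x≢y : x ≢ y) where

  contractVertex : Fin (suc m) → Fin m
  contractVertex a with a ≟ y
  ... | yes _  = punchOut (x≢y ∘ sym)
  ... | no a≢y = punchOut (a≢y ∘ sym)

  -- Positions are compared after `punchIn y`, since `contract` reads its colours there.
  data VertexView (a : Fin (suc m)) : Set where
    merged : a ≡ x ⊎ a ≡ y → punchIn y (contractVertex a) ≡ x → VertexView a
    kept   : a ≢ x → a ≢ y → punchIn y (contractVertex a) ≡ a → VertexView a

  punchIn-contractVertex-y : punchIn y (contractVertex y) ≡ x
  punchIn-contractVertex-y with y ≟ y
  ... | yes _  = punchIn-punchOut (x≢y ∘ sym)
  ... | no y≢y = contradiction refl y≢y

  punchIn-contractVertex : ∀ {a} → a ≢ y → punchIn y (contractVertex a) ≡ a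
  punchIn-contractVertex {a} a≢y with a ≟ y
  ... | yes a≡y = contradiction a≡y a≢y
  ... | no a≢y′ = punchIn-punchOut (a≢y′ ∘ sym)

  vertexView : ∀ a → VertexView a
  vertexView a with a ≟ y | a ≟ x
  ... | yes refl | _        = merged (inj₂ refl) punchIn-contractVertex-y
  ... | no a≢y   | yes refl = merged (inj₁ refl) (punchIn-contractVertex a≢y)
  ... | no a≢y   | no a≢x   = kept a≢x a≢y (punchIn-contractVertex a≢y)

  contractVertex-kept : ∀ {a b} → a ≢ x → a ≢ y → contractVertex b ≡ contractVertex a → b ≡ a
  contractVertex-kept {a} {b} a≢x a≢y eq with vertexView b
  ... | merged _ b↦x = contradiction
          (trans (sym (punchIn-contractVertex a≢y)) (trans (sym (cong (punchIn y) eq)) b↦x)) a≢x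
  ... | kept _ _ b↦b = trans (sym b↦b) (trans (cong (punchIn y) eq) (punchIn-contractVertex a≢y))

  contractVertex-merged : ∀ {a b} → a ≡ x ⊎ a ≡ y → contractVertex b ≡ contractVertex a → b ≡ x ⊎ b ≡ y
  contractVertex-merged {a} {b} a∈ eq with vertexView b
  ... | merged b∈ _    = b∈
  ... | kept b≢x b≢y _ =
          subst (λ c → c ≡ x ⊎ c ≡ y) (contractVertex-kept {a = b} {b = a} b≢x b≢y (sym eq)) a∈

  -- Serves both colours constrained by `Quotient`, black and none: a merged edge has such a colour
  -- only if both of its halves have it. Distinct images exclude the pair `x`, `y`, whose own colour
  -- is lost in the contraction.
  contract-colour : ∀ (T : Trigraph (suc m)) {c a b} → contractVertex a ≢ contractVertex b → c ≢ red →
                    colour (contract T x y) (contractVertex a) (contractVertex b) ≡ c → colour T a b ≡ c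
  contract-colour T {c} {a} {b} a≁b c≢red eq with vertexView a | vertexView b
  ... | merged _ a↦x | merged _ b↦x =
          contradiction (punchIn-injective y _ _ (trans a↦x (sym b↦x))) a≁b
  ... | kept a≢x _ a↦a | kept b≢x _ b↦b rewrite a↦a | b↦b =
          trans (sym (contractColour-kept T x y a≢x b≢x)) eq
  ... | merged a∈ a↦x | kept b≢x _ b↦b rewrite a↦x | b↦b
        with a∈ | merge-≢red (colour T x b) (colour T y b) c≢red
                    (trans (sym (contractColour-merged T x y b≢x)) eq)
  ...   | inj₁ refl | xb , _  = xb
  ...   | inj₂ refl | _  , yb = yb
  contract-colour T {c} {a} {b} a≁b c≢red eq
      | kept a≢x _ a↦a | merged b∈ b↦x rewrite a↦a | b↦x
        with b∈ | merge-≢red (colour T x a) (colour T y a) c≢red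
                    (trans (sym (trans (contractColour-sym T x y a x) (contractColour-merged T x y a≢x))) eq)
  ...   | inj₁ refl | xa , _  = trans (colour-sym T a x) xa
  ...   | inj₂ refl | _  , ya = trans (colour-sym T a y) ya

  contract-quotient : {G : Graph n} {T : Trigraph (suc m)} {π : Fin n → Fin (suc m)} →
                      Quotient G T π → Quotient G (contract T x y) (contractVertex ∘ π)
  contract-quotient {T = T} {π} Q = record
    { black⇒adj = λ u w eq → black⇒adj Q u w (contract-colour T (distinct eq) (λ ()) eq)
    ; adj⇒edge  = λ u w uw u≁w eq → adj⇒edge Q u w uw (u≁w ∘ cong contractVertex)
                                      (contract-colour T u≁w (λ ()) eq)
    }
    where
    -- Loops are uncoloured, so a black edge joins distinct parts, as `contract-colour` demands.
    distinct : ∀ {a b} → colour (contract T x y) a b ≡ black → a ≢ b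
    distinct {a} eq refl with trans (sym eq) (colour-loop (contract T x y) a)
    ... | ()

toTrigraph-quotient : (G : Graph n) → Quotient G (toTrigraph G) id
toTrigraph-quotient G = record { black⇒adj = black⇒ ; adj⇒edge = λ u w uw _ → edge u w uw }
  where
  black⇒ : ∀ u w → edgeColour G u w ≡ black → Adj G u w
  black⇒ u w eq with adj? G u w
  ... | yes uw = uw

  edge : ∀ u w → Adj G u w → edgeColour G u w ≢ none
  edge u w uw eq with adj? G u w
  ... | no ¬uw = ¬uw uw

sequence-degree : ∀ {d} {T : Trigraph m} → ContractionSequence d T → MaxRedDegree≤ d T
sequence-degree (stop deg)         = deg
sequence-degree (step deg _ _ _ _) = deg

-- Ranking vertices by the time at which their part becomes large

Peer : (Fin n → ℕ) → (Fin n → Fin m) → Fin n → Fin n → Set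
Peer rank π v u = rank u ℕ.≤ rank v × π u ≡ π v

peer? : (rank : Fin n → ℕ) (π : Fin n → Fin m) (v : Fin n) → Unary.Decidable (Peer rank π v)
peer? rank π v u = (rank u ℕ.≤? rank v) ×-dec (π u ≟ π v)

module _ (G : Graph n) (s d : ℕ) where
  open Large s

  -- The trigraph in which the part of v has just become large.
  record Stage (π₀ : Fin n → Fin m) (rank : Fin n → ℕ) (v : Fin n) : Set where
    field
      {size}    : ℕ
      {tri}     : Trigraph size
      {π}       : Fin n → Fin size
      quotient  : Quotient G tri π
      degree    : MaxRedDegree≤ d tri
      persists  : ∀ {w} → Large π₀ (π₀ w) → Large π (π w)
      above     : ∀ {w} → rank v ℕ.≤ rank w → Large π (π w)
      below     : ∀ {u} → rank u ℕ.≤ rank v → π u ≢ π v → ¬ Large π (π u)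
      few       : length (elements (peer? rank π v)) ℕ.≤ s ℕ.+ s

  -- The rank of a vertex is the number of parts when its part becomes large.
  record Ranking (π₀ : Fin n → Fin m) : Set where
    field
      rank       : Fin n → ℕ
      rank-large : ∀ {w} → Large π₀ (π₀ w) → rank w ≡ m
      rank-small : ∀ {w} → ¬ Large π₀ (π₀ w) → rank w ℕ.< m
      stage      : ∀ {v} → ¬ Large π₀ (π₀ v) → Stage π₀ rank v

  module _ {T : Trigraph (suc m)} {π : Fin n → Fin (suc m)} {x y : Fin (suc m)} (x≢y : x ≢ y)
           (Q : Quotient G T π) (deg : MaxRedDegree≤ d (contract T x y))
           (R : Ranking (contractVertex x≢y ∘ π)) where

    private
      module R = Ranking R

      π′ : Fin n → Fin m
      π′ = contractVertex x≢y ∘ π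

    large⇒large′ : ∀ {w} → Large π (π w) → Large π′ (π′ w)
    large⇒large′ {w} large = ℕ.≤-trans large
      (length-elements-≤ (λ u → π u ≟ π w) λ eq →
        ∈-elements⁺ (λ u → π′ u ≟ π′ w) (cong (contractVertex x≢y) eq))

    kept-large′⇒large : ∀ {w} → π w ≢ x → π w ≢ y → Large π′ (π′ w) → Large π (π w)
    kept-large′⇒large {w} w≢x w≢y large = ℕ.≤-trans large
      (length-elements-≤ (λ u → π′ u ≟ π′ w) λ eq →
        ∈-elements⁺ (λ u → π u ≟ π w) (contractVertex-kept x≢y w≢x w≢y eq))

    R-rank≤ : ∀ w → R.rank w ℕ.≤ m
    R-rank≤ w with large? π′ (π′ w)
    ... | yes large = ℕ.≤-reflexive (R.rank-large large)
    ... | no small  = ℕ.<⇒≤ (R.rank-small small)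

    -- Prepending a contraction splits the top rank `m`: vertices whose part is large before it move
    -- up to `suc m`, and those whose part it makes large stay at `m`.
    step-rank : Fin n → ℕ
    step-rank u with large? π (π u)
    ... | yes _ = suc m
    ... | no _  = R.rank u

    step-rank-large : ∀ {w} → Large π (π w) → step-rank w ≡ suc m
    step-rank-large {w} large with large? π (π w)
    ... | yes _    = refl
    ... | no small = contradiction large small

    step-rank-small : ∀ {w} → ¬ Large π (π w) → step-rank w ≡ R.rank w
    step-rank-small {w} small with large? π (π w)
    ... | yes large = contradiction large small
    ... | no _      = refl

    module _ {v} (small-v : ¬ Large π (π v)) where

      step-rank-≤⇒small : ∀ {u} → step-rank u ℕ.≤ step-rank v → ¬ Large π (π u)
      step-rank-≤⇒small {u} le large = ℕ.<⇒≱ (s≤s (R-rank≤ v))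
        (ℕ.≤-trans (ℕ.≤-reflexive (sym (step-rank-large large)))
          (ℕ.≤-trans le (ℕ.≤-reflexive (step-rank-small small-v))))

      step-rank-≤⇒R : ∀ {u} → step-rank u ℕ.≤ step-rank v → R.rank u ℕ.≤ R.rank v
      step-rank-≤⇒R le =
        ℕ.≤-trans (ℕ.≤-reflexive (sym (step-rank-small (step-rank-≤⇒small le))))
          (ℕ.≤-trans le (ℕ.≤-reflexive (step-rank-small small-v)))

      step-rank-≥⇒R : ∀ {w} → ¬ Large π (π w) → step-rank v ℕ.≤ step-rank w → R.rank v ℕ.≤ R.rank w
      step-rank-≥⇒R small le =
        ℕ.≤-trans (ℕ.≤-reflexive (sym (step-rank-small small-v)))
          (ℕ.≤-trans le (ℕ.≤-reflexive (step-rank-small small)))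

      -- The only ranks that change are those of vertices in parts already large in `T`, and
      -- `persists` puts these in large parts at the stage of `v`.
      later-stage : Stage π′ R.rank v → Stage π step-rank v
      later-stage S = record
        { quotient = S.quotient
        ; degree   = S.degree
        ; persists = S.persists ∘ large⇒large′
        ; above    = above
        ; below    = S.below ∘ step-rank-≤⇒R
        ; few      = ℕ.≤-trans
                       (length-elements-≤ (peer? step-rank S.π v) {ys = elements (peer? R.rank S.π v)}
                         λ (le , eq) → ∈-elements⁺ (peer? R.rank S.π v) (step-rank-≤⇒R le , eq))
                       S.few
        }
        where
        module S = Stage S
        above : ∀ {w} → step-rank v ℕ.≤ step-rank w → Large S.π (S.π w)
        above {w} le with large? π (π w)
        ... | yes large = S.persists (large⇒large′ large)
        ... | no small  = S.above (ℕ.≤-trans (ℕ.≤-reflexive (sym (step-rank-small small-v))) le)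

      -- A part that is not merged keeps its vertices, so the part of `v` can become large only by
      -- being merged: it is now the union of the parts `x` and `y`.
      this-stage : Large π′ (π′ v) → Stage π step-rank v
      this-stage large′-v = record
        { quotient = contract-quotient x≢y Q
        ; degree   = deg
        ; persists = large⇒large′
        ; above    = above
        ; below    = below
        ; few      = few
        }
        where
        v-merged : π v ≡ x ⊎ π v ≡ y
        v-merged with vertexView x≢y (π v)
        ... | merged v∈ _      = v∈
        ... | kept v≢x v≢y _ = contradiction (kept-large′⇒large v≢x v≢y large′-v) small-v

        above : ∀ {w} → step-rank v ℕ.≤ step-rank w → Large π′ (π′ w)
        above {w} le with large? π′ (π′ w)
        ... | yes large′ = large′
        -- Here `v` has rank `m` in `R`, whereas a vertex still in a small part after the
        -- contraction has rank below `m`.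
        ... | no small′  = contradiction
          (ℕ.≤-trans (ℕ.≤-reflexive (sym (R.rank-large large′-v))) (step-rank-≥⇒R (small′ ∘ large⇒large′) le))
          (ℕ.<⇒≱ (R.rank-small small′))

        below : ∀ {u} → step-rank u ℕ.≤ step-rank v → π′ u ≢ π′ v → ¬ Large π′ (π′ u)
        below {u} le u≁v large′ with vertexView x≢y (π u) | vertexView x≢y (π v)
        ... | kept u≢x u≢y _ | _ = step-rank-≤⇒small le (kept-large′⇒large u≢x u≢y large′)
        ... | merged _ u↦x | merged _ v↦x = u≁v (punchIn-injective y _ _ (trans u↦x (sym v↦x)))
        ... | merged _ _   | kept v≢x v≢y _ = [ v≢x , v≢y ]′ v-merged

        -- A merged part that was already large contributes no peers: its vertices have rank
        -- `suc m`, above that of `v`.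
        smallPart : Fin (suc m) → List (Fin n)
        smallPart W with large? π W
        ... | yes _ = []
        ... | no _  = part π W

        length-smallPart : ∀ W → length (smallPart W) ℕ.≤ s
        length-smallPart W with large? π W
        ... | yes _    = z≤n
        ... | no small = ℕ.≮⇒≥ small

        ∈-smallPart : ∀ {u} → ¬ Large π (π u) → u ∈ smallPart (π u)
        ∈-smallPart {u} small with large? π (π u)
        ... | yes large = contradiction large small
        ... | no _      = ∈-part π u

        cover : ∀ {u} → Peer step-rank π′ v u → u ∈ smallPart x ++ smallPart y
        cover {u} (le , eq) with contractVertex-merged x≢y v-merged eq
        ... | inj₁ u∈x = ∈-++⁺ˡ (subst (λ W → u ∈ smallPart W) u∈x (∈-smallPart (step-rank-≤⇒small le)))
        ... | inj₂ u∈y = ∈-++⁺ʳ (smallPart x)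
                           (subst (λ W → u ∈ smallPart W) u∈y (∈-smallPart (step-rank-≤⇒small le)))

        few : length (elements (peer? step-rank π′ v)) ℕ.≤ s ℕ.+ s
        few = begin
          length (elements (peer? step-rank π′ v))          ≤⟨ length-elements-≤ (peer? step-rank π′ v) cover ⟩
          length (smallPart x ++ smallPart y)               ≡⟨ length-++ (smallPart x) ⟩
          length (smallPart x) ℕ.+ length (smallPart y)     ≤⟨ ℕ.+-mono-≤ (length-smallPart x) (length-smallPart y) ⟩
          s ℕ.+ s                                           ∎
          where open ℕ.≤-Reasoning

    step-ranking : Ranking π
    step-ranking = record
      { rank       = step-rank
      ; rank-large = step-rank-large
      ; rank-small = λ {w} small → s≤s (ℕ.≤-trans (ℕ.≤-reflexive (step-rank-small small)) (R-rank≤ w))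
      ; stage      = stage
      }
      where
      stage : ∀ {v} → ¬ Large π (π v) → Stage π step-rank v
      stage {v} small with large? π′ (π′ v)
      ... | yes large′ = this-stage small large′
      ... | no small′  = later-stage small (R.stage small′)

  -- Built backwards from the end of the sequence. There the only part is V(G), which is large, so
  -- the statements about small parts hold vacuously.
  ranking : s ℕ.< n → {T : Trigraph m} {π : Fin n → Fin m} →
            ContractionSequence d T → Quotient G T π → Ranking π
  ranking s<n {π = π} (stop _) Q = record
    { rank       = λ _ → 1
    ; rank-large = λ _ → refl
    ; rank-small = λ {w} small → contradiction (large w) small
    ; stage      = λ {v} small → contradiction (large v) small
    }
    where
    unique : ∀ (a b : Fin 1) → a ≡ b
    unique zero zero = refl

    large : ∀ w → Large π (π w)
    large w = ℕ.≤-trans s<n (ℕ.≤-trans (ℕ.≤-reflexive (sym (length-tabulate id)))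
      (length-⊆ (Unique.allFin⁺ n) λ {u} _ → ∈-elements⁺ (λ u → π u ≟ π w) (unique (π u) (π w))))
  ranking s<n (step _ x y x≢y cs) Q =
    -- The degree bound is taken after the contraction, in the trigraph where the new part `Z`
    -- exists.
    step-ranking x≢y Q (sequence-degree cs) (ranking s<n cs (contract-quotient x≢y Q))

-- The linear order of a ranking

module _ (rank : Fin n → ℕ) where

  -- The lexicographic order by rank and then index, packed into one number: indices are below `n`,
  -- so the rank dominates. Low ranks, which are late times, come first.
  key : Fin n → ℕ
  key x = rank x ℕ.* n ℕ.+ toℕ x

  key-≤⇒rank-≤ : ∀ {x y} → key x ℕ.≤ key y → rank x ℕ.≤ rank y
  key-≤⇒rank-≤ {x} {y} le = ℕ.≮⇒≥ λ lt → ℕ.<⇒≱ (begin-strict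
    rank y ℕ.* n ℕ.+ toℕ y   <⟨ ℕ.+-monoʳ-< (rank y ℕ.* n) (toℕ<n y) ⟩
    rank y ℕ.* n ℕ.+ n       ≡⟨ ℕ.+-comm (rank y ℕ.* n) n ⟩
    suc (rank y) ℕ.* n       ≤⟨ ℕ.*-monoˡ-≤ n lt ⟩
    rank x ℕ.* n             ≤⟨ ℕ.m≤m+n _ _ ⟩
    key x                    ∎) le
    where open ℕ.≤-Reasoning

  key-injective : ∀ {x y} → key x ≡ key y → x ≡ y
  key-injective {x} {y} eq = toℕ-injective (ℕ.+-cancelˡ-≡ (rank x ℕ.* n) _ _
    (trans eq (cong (λ k → k ℕ.* n ℕ.+ toℕ y) (sym rank-eq))))
    where
    rank-eq : rank x ≡ rank y
    rank-eq = ℕ.≤-antisym (key-≤⇒rank-≤ (ℕ.≤-reflexive eq)) (key-≤⇒rank-≤ (ℕ.≤-reflexive (sym eq)))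

  rankOrder : LinearOrder n
  rankOrder = record
    { _≤ᴸ_            = λ x y → key x ℕ.≤ key y
    ; isDecTotalOrder = record
      { isTotalOrder = record
        { isPartialOrder = record
          { isPreorder = record
            { isEquivalence = isEquivalence
            ; reflexive     = λ eq → ℕ.≤-reflexive (cong key eq)
            ; trans         = ℕ.≤-trans
            }
          ; antisym = λ p q → key-injective (ℕ.≤-antisym p q)
          }
        ; total = λ x y → ℕ.≤-total (key x) (key y)
        }
      ; _≟_  = _≟_
      ; _≤?_ = λ x y → key x ℕ.≤? key y
      }
    }

-- Counting the strongly reachable vertices

module _ (G : Graph n) {s d : ℕ} (no-K : ¬ IsSubgraph (K (suc s) (suc s)) G) (r : ℕ)
         {π₀ : Fin n → Fin m} {rank : Fin n → ℕ} where
  open Large s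

  ∣Sreach∣≤ : ∀ {v} → Stage G s d π₀ rank v →
              ∣ Sreach G (rankOrder rank) r v ∣ ℕ.≤ (3 ℕ.+ treeSize d r) ℕ.* s
  ∣Sreach∣≤ {v} S = begin
    ∣ Sreach G (rankOrder rank) r v ∣                       ≡⟨ ∣subset∣≡length-elements reach? ⟩
    length (elements reach?)                                ≤⟨ length-elements-≤ reach? cover ⟩
    length (peers ++ out)                                    ≡⟨ length-++ peers ⟩
    length peers ℕ.+ length out                              ≤⟨ ℕ.+-mono-≤ few (length-outside G no-K quotient (π v) large-v r degree) ⟩
    -- The product unfolds to `s + (s + (s + treeSize d r * s))`: two copies of `s` for the peers
    -- and one for the black neighbours of the part of `v`.
    s ℕ.+ s ℕ.+ (s ℕ.+ treeSize d r ℕ.* s)                  ≡⟨ ℕ.+-assoc s s _ ⟩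
    (3 ℕ.+ treeSize d r) ℕ.* s                              ∎
    where
    open ℕ.≤-Reasoning
    open Stage S

    reach? : Unary.Decidable (StronglyReachable G (rankOrder rank) r v)
    reach? = stronglyReachable? G (rankOrder rank) r v

    large-v : Large π (π v)
    large-v = above ℕ.≤-refl

    peers out : List (Fin n)
    peers = elements (peer? rank π v)
    out   = outside G no-K quotient (π v) large-v r

    cover : ∀ {u} → StronglyReachable G (rankOrder rank) r v u → u ∈ peers ++ out
    cover {u} (u≤v , k , k≤r , p , path , start , end , inner) with π u ≟ π v
    ... | yes eq = ∈-++⁺ˡ (∈-elements⁺ (peer? rank π v) (key-≤⇒rank-≤ rank u≤v , eq))
    cover {u} (u≤v , zero , k≤r , p , path , start , end , inner) | no u≁v =
      contradiction (cong π (trans (sym end) start)) u≁v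
    cover {u} (u≤v , suc k , k≤r , p , isPath _ adj , refl , refl , inner) | no u≁v = ∈-++⁺ʳ peers
      (walk⊆outside G no-K quotient (π v) large-v r k {0} p adj large (inj₁ refl) k≤r
        (below (key-≤⇒rank-≤ rank u≤v) u≁v) u≁v)
      where
      -- The indices up to `k` are all vertices but the endpoint: `v` first, then inner vertices,
      -- which come after `v` in the order and so have at least its rank.
      large : ∀ i → toℕ i ℕ.≤ k → Large π (π (p i))
      large zero    _   = large-v
      large (suc i) i≤k = above (key-≤⇒rank-≤ rank (proj₁ (inner (suc i) (s≤s z≤n) (s≤s i≤k))))

scol≤ : (G : Graph n) (L : LinearOrder n) (r b : ℕ) →
        (∀ v → ∣ Sreach G L r v ∣ ℕ.≤ b) → scol r G ℕ.≤ b
scol≤ G L r b h = ℕ.≤-trans (proj₂ (scol-isMinimum G r) _ (L , refl)) (Extrema.max≤v⁺ z≤n (All.tabulate⁺ h))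

scol≤treeSize : (G : Graph n) → HasEdge G → ∀ r → scol r G ℕ.≤ (3 ℕ.+ treeSize (tww G) r) ℕ.* ω̄ G
scol≤treeSize {suc n} G e r = scol≤ G (rankOrder rank) r _ λ v → ∣Sreach∣≤ G (¬biclique G) r (stage (small v))
  where
  open Large (ω̄ G)
  open Ranking (ranking G (ω̄ G) (tww G) (ω̄<n G e) (proj₁ (tww-isMinimum G)) (toTrigraph-quotient G))

  -- The sequence starts from singletons, which are small since `ω̄ G` is at least 1; hence every
  -- vertex has a stage.
  small : ∀ v → ¬ Large id v
  small v = ℕ.≤⇒≯ (ℕ.≤-trans (length-elements-≤ (_≟ v) {ys = v ∷ []} here) (HasEdge⇒1≤ω̄ G e))

-- Arithmetic

pos-^ : ∀ k i → + (k ℕ.^ i) ≡ (+ k) ^ i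
pos-^ k zero    = refl
pos-^ k (suc i) = trans (ℤ.pos-* k (k ℕ.^ i)) (cong (+ k *_) (pos-^ k i))

-- Truncated and integer subtraction disagree only at `d = 0`, where the factor `d` makes both sides
-- vanish.
pos-treeSize : ∀ d r → + treeSize d r ≡ + d * ∑[ i < r ] ((+ d - + 1) ^ i)
pos-treeSize zero    zero    = refl
pos-treeSize zero    (suc r) = cong (_+ + 0) (pos-treeSize zero r)
pos-treeSize (suc e) zero    = sym (ℤ.*-zeroʳ (+ suc e))
pos-treeSize (suc e) (suc r) = begin
  + (treeSize (suc e) r ℕ.+ suc e ℕ.* e ℕ.^ r)             ≡⟨ ℤ.pos-+ (treeSize (suc e) r) _ ⟩
  + treeSize (suc e) r + + (suc e ℕ.* e ℕ.^ r)             ≡⟨ cong₂ _+_ (pos-treeSize (suc e) r) (trans (ℤ.pos-* (suc e) (e ℕ.^ r)) (cong (+ suc e *_) (pos-^ e r))) ⟩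
  + suc e * ∑[ i < r ] ((+ e) ^ i) + + suc e * (+ e) ^ r   ≡⟨ ℤ.*-distribˡ-+ (+ suc e) (∑[ i < r ] ((+ e) ^ i)) ((+ e) ^ r) ⟨
  + suc e * ∑[ i < suc r ] ((+ e) ^ i)                     ∎
  where open ≡-Reasoning

-- In each new term one factor `d - 1` is kept and the others are raised to `d`, so that d^(r+1) +
-- (d-1) d^(r+1) = d^(r+2). The first term has no such factor, so the induction starts at radius 1.
treeSize≤^ : ∀ d r → treeSize d (suc r) ℕ.≤ d ℕ.^ suc r
treeSize≤^ d       zero    = ℕ.≤-refl
treeSize≤^ zero    (suc r) = ℕ.≤-trans (ℕ.≤-reflexive (ℕ.+-identityʳ (treeSize 0 (suc r)))) (treeSize≤^ zero r)
treeSize≤^ (suc e) (suc r) = begin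
  treeSize (suc e) (suc r) ℕ.+ suc e ℕ.* (e ℕ.* e ℕ.^ r)       ≤⟨ ℕ.+-mono-≤ (treeSize≤^ (suc e) r) (ℕ.*-monoʳ-≤ (suc e) (ℕ.*-monoʳ-≤ e (ℕ.^-monoˡ-≤ r (ℕ.n≤1+n e)))) ⟩
  suc e ℕ.* t ℕ.+ suc e ℕ.* (e ℕ.* t)                          ≡⟨ ℕ.*-distribˡ-+ (suc e) t (e ℕ.* t) ⟨
  suc e ℕ.* (suc e ℕ.* t)                                      ∎
  where
  open ℕ.≤-Reasoning
  t = suc e ℕ.^ r

pos-bound : ∀ d w r → + ((3 ℕ.+ treeSize d r) ℕ.* w) ≡ (+ 3 + + d * ∑[ i < r ] ((+ d - + 1) ^ i)) * + w
pos-bound d w r = trans (ℤ.pos-* (3 ℕ.+ treeSize d r) w) (cong (λ t → (+ 3 + t) * + w) (pos-treeSize d r))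

bound≤power : ∀ d w r → (3 ℕ.+ treeSize d (suc r)) ℕ.* w ℕ.≤ (d ℕ.^ suc r ℕ.+ 3) ℕ.* w
bound≤power d w r = ℕ.*-monoˡ-≤ w (subst (ℕ._≤ d ℕ.^ suc r ℕ.+ 3) (ℕ.+-comm _ 3) (ℕ.+-monoˡ-≤ 3 (treeSize≤^ d r)))

pos-power : ∀ d w r → + ((d ℕ.^ r ℕ.+ 3) ℕ.* w) ≡ ((+ d) ^ r + + 3) * + w
pos-power d w r = trans (ℤ.pos-* (d ℕ.^ r ℕ.+ 3) w) (cong (λ t → (t + + 3) * + w) (pos-^ d r))

pos-bounds : ∀ c d w r → c ℕ.≤ (3 ℕ.+ treeSize d (suc r)) ℕ.* w →
  (+ c ≤ (+ 3 + + d * ∑[ i < suc r ] ((+ d - + 1) ^ i)) * + w)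
  × ((+ 3 + + d * ∑[ i < suc r ] ((+ d - + 1) ^ i)) * + w ≤ ((+ d) ^ suc r + + 3) * + w)
pos-bounds c d w r c≤ =
  subst (+ c ≤_) (pos-bound d w (suc r)) (ℤ.+≤+ c≤) ,
  subst₂ _≤_ (pos-bound d w (suc r)) (pos-power d w (suc r)) (ℤ.+≤+ (bound≤power d w r))

theorem2 : ∀ {n} (G : Graph n) → HasEdge G → ∀ r → 1 ℕ.≤ r →
    (+ scol r G ≤ (+ 3 + + tww G * ∑[ i < r ] ((+ tww G - + 1) ^ i)) * + ω̄ G)
    × ((+ 3 + + tww G * ∑[ i < r ] ((+ tww G - + 1) ^ i)) * + ω̄ G ≤ ((+ tww G) ^ r + + 3) * + ω̄ G)
theorem2 G e (suc r) _ = pos-bounds (scol (suc r) G) (tww G) (ω̄ G) r (scol≤treeSize G e (suc r))
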